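{- Let $G$ be a finite simple graph with $n$ vertices ($n\ge 1$), and let $d_1 \leqslant \dots \leqslant d_n$ be the degrees of its vertices. Let $\tau(G)$ denote the number of spanning trees of $G$. Then $$\tau(G) \leqslant \frac{(1+d_1)(1+d_2)\cdots(1+d_n)}{n^2}.$$
   Context: A simple graph is an undirected graph without loops and without multiple edges. $\tau(G)$ is the number of spanning trees of $G$, i.e. of subgraphs of $G$ that are trees containing all vertices of $G$. -}

module Defs where

open import Data.Fin.Base as Fin using (Fin)
open import Data.Fin.Properties as Fin using (injective⇒≤; <-irrefl; any?; all?)
open import Data.Fin.Subset using (Subset; inside; outside; _∈_)
open import Data.Fin.Subset.Properties using (_∈?_)
open import Data.List.Base
  using (List; []; _∷_; _∷ʳ_; length; lookup; filter; map; allFin; cartesianProduct; cartesianProductWith)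
import Data.List.Membership.Propositional as List
open import Data.List.Membership.Propositional.Properties using (∈-allFin; ∈-lookup)
open import Data.List.Relation.Unary.All as All using ()
open import Data.List.Relation.Unary.All.Properties using (all-filter)
open import Data.List.Relation.Unary.Any using (here; there)
open import Data.List.Relation.Unary.Linked using (Linked; linked?)
open import Data.List.Relation.Unary.Unique.Propositional using (Unique)
open import Data.List.Relation.Unary.AllPairs using (_∷_)
open import Data.List.Relation.Unary.Unique.DecPropositional using (unique?)
open import Data.Nat.Base using (ℕ; zero; suc; _≤_)
open import Data.Nat.Properties using (_≤?_; anyUpTo?)
open import Data.Product.Base using (∃-syntax; _×_; _,_; proj₁; proj₂)
open import Data.Product.Properties using (≡-dec)
open import Data.Sum.Base as Sum using (_⊎_; inj₁; inj₂)
open import Data.Vec.Base using ([]; _∷_)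
open import Function.Base using (_∘_)
open import Level using (0ℓ)
open import Relation.Binary.Construct.Closure.ReflexiveTransitive using (Star; ε; _◅_; _◅◅_)
open import Relation.Binary.Core using (Rel)
open import Relation.Binary.Definitions using (Decidable; Symmetric; Irreflexive)
open import Relation.Binary.PropositionalEquality using (_≡_; refl; sym; cong)
open import Relation.Nullary.Decidable.Core using (Dec; map′; _×-dec_; _⊎-dec_; ¬?)
open import Relation.Nullary.Negation using (¬_; contradiction)
open import Relation.Unary as Unary using (Pred)

private
  variable
    n : ℕ

------------------------------------------------------------------------
-- Simple graphs with vertex set Fin n

record SimpleGraph (n : ℕ) : Set₁ where
  infix 4 _~_ _~?_
  field
    _~_    : Rel (Fin n) 0ℓ
    _~?_   : Decidable _~_
    ~-sym  : Symmetric _~_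
    ~-irr  : Irreflexive _≡_ _~_

degree : SimpleGraph n → Fin n → ℕ
degree {n} G v = length (filter (v ~?_) (allFin n))
  where open SimpleGraph G

degrees : SimpleGraph n → List ℕ
degrees {n} G = map (degree G) (allFin n)

-- Every edge {i , j} is listed exactly once, as the pair with i < j.
isEdge? : (G : SimpleGraph n) →
          Unary.Decidable (λ ((i , j) : Fin n × Fin n) → i Fin.< j × SimpleGraph._~_ G i j)
isEdge? G (i , j) = i Fin.<? j ×-dec i ~? j
  where open SimpleGraph G

edges : SimpleGraph n → List (Fin n × Fin n)
edges {n} G = filter (isEdge? G) (cartesianProduct (allFin n) (allFin n))

------------------------------------------------------------------------
-- Trees

Connected : SimpleGraph n → Set
Connected G = ∀ u v → Star _~_ u v
  where open SimpleGraph G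

-- The cycle v , v₁ , … , vₖ , v with vs = v₁ , … , vₖ.
IsCycle : SimpleGraph n → Fin n → List (Fin n) → Set
IsCycle G v vs = Linked _~_ (v ∷ vs ∷ʳ v) × Unique (v ∷ vs) × 2 ≤ length vs
  where open SimpleGraph G

Acyclic : SimpleGraph n → Set
Acyclic G = ¬ (∃[ v ] ∃[ vs ] IsCycle G v vs)

IsTree : SimpleGraph n → Set
IsTree G = Connected G × Acyclic G

------------------------------------------------------------------------
-- Decidability of being a tree

module _ {_~_ : Rel (Fin n) 0ℓ} (_~?_ : Decidable _~_) where

  -- There is a walk from u to v all of whose inner vertices lie in the list.
  private
    Via : List (Fin n) → Rel (Fin n) 0ℓ
    Via []       u v = u ≡ v ⊎ u ~ v
    Via (x ∷ xs) u v = Via xs u v ⊎ (Via xs u x × Via xs x v)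

    via? : ∀ xs → Decidable (Via xs)
    via? []       u v = u Fin.≟ v ⊎-dec u ~? v
    via? (x ∷ xs) u v = via? xs u v ⊎-dec (via? xs u x ×-dec via? xs x v)

    via-refl : ∀ xs {u} → Via xs u u
    via-refl []       = inj₁ refl
    via-refl (x ∷ xs) = inj₁ (via-refl xs)

    via-step : ∀ xs {u v} → u ~ v → Via xs u v
    via-step []       e = inj₂ e
    via-step (x ∷ xs) e = inj₁ (via-step xs e)

    via⇒star : ∀ xs {u v} → Via xs u v → Star _~_ u v
    via⇒star []       (inj₁ refl)    = ε
    via⇒star []       (inj₂ e)       = e ◅ ε
    via⇒star (x ∷ xs) (inj₁ p)       = via⇒star xs p
    via⇒star (x ∷ xs) (inj₂ (p , q)) = via⇒star xs p ◅◅ via⇒star xs q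

    via-to : ∀ x xs {u} → Via (x ∷ xs) u x → Via xs u x
    via-to x xs (inj₁ p)       = p
    via-to x xs (inj₂ (p , _)) = p

    via-from : ∀ x xs {v} → Via (x ∷ xs) x v → Via xs x v
    via-from x xs (inj₁ q)       = q
    via-from x xs (inj₂ (_ , q)) = q

    via-trans : ∀ xs {u w v} → w List.∈ xs → Via xs u w → Via xs w v → Via xs u v
    via-trans (x ∷ xs) (here refl) p q = inj₂ (via-to x xs p , via-from x xs q)
    via-trans (x ∷ xs) (there w∈)  (inj₁ p)       (inj₁ q)       = inj₁ (via-trans xs w∈ p q)
    via-trans (x ∷ xs) (there w∈)  (inj₁ p)       (inj₂ (q , r)) = inj₂ (via-trans xs w∈ p q , r)
    via-trans (x ∷ xs) (there w∈)  (inj₂ (p , q)) (inj₁ r)       = inj₂ (p , via-trans xs w∈ q r)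
    via-trans (x ∷ xs) (there w∈)  (inj₂ (p , _)) (inj₂ (_ , r)) = inj₂ (p , r)

    star⇒via : ∀ {u v} → Star _~_ u v → Via (allFin n) u v
    star⇒via ε       = via-refl (allFin n)
    star⇒via (e ◅ p) = via-trans (allFin n) (∈-allFin _) (via-step (allFin n) e) (star⇒via p)

  star? : Decidable (Star _~_)
  star? u v = map′ (via⇒star (allFin n)) star⇒via (via? (allFin n) u v)

connected? : (G : SimpleGraph n) → Dec (Connected G)
connected? G = all? λ u → all? λ v → star? _~?_ u v
  where open SimpleGraph G

private
  anyOfLength? : ∀ {P : Pred (List (Fin n)) 0ℓ} → Unary.Decidable P →
                 ∀ k → Dec (∃[ xs ] (length xs ≡ k × P xs))
  anyOfLength? P? zero =
    map′ (λ p → [] , refl , p) (λ { ([] , _ , p) → p }) (P? [])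
  anyOfLength? P? (suc k) =
    map′ (λ { (x , xs , refl , p) → x ∷ xs , refl , p })
         (λ { (x ∷ xs , refl , p) → x , xs , refl , p })
         (any? λ x → anyOfLength? (P? ∘ (x ∷_)) k)

  lookup-injective : ∀ {xs : List (Fin n)} → Unique xs →
                     ∀ {i j} → lookup xs i ≡ lookup xs j → i ≡ j
  lookup-injective (_ ∷ _)  {Fin.zero}  {Fin.zero}  _  = refl
  lookup-injective (x∉ ∷ _) {Fin.zero}  {Fin.suc j} eq = contradiction eq (All.lookup x∉ (∈-lookup j))
  lookup-injective (x∉ ∷ _) {Fin.suc i} {Fin.zero}  eq = contradiction (sym eq) (All.lookup x∉ (∈-lookup i))
  lookup-injective (_ ∷ u)  {Fin.suc i} {Fin.suc j} eq = cong Fin.suc (lookup-injective u eq)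

  unique⇒length≤ : ∀ {xs : List (Fin n)} → Unique xs → length xs ≤ n
  unique⇒length≤ u = injective⇒≤ (lookup-injective u)

isCycle? : (G : SimpleGraph n) → ∀ v vs → Dec (IsCycle G v vs)
isCycle? G v vs = linked? _~?_ (v ∷ vs ∷ʳ v) ×-dec unique? Fin._≟_ (v ∷ vs) ×-dec 2 ≤? length vs
  where open SimpleGraph G

acyclic? : (G : SimpleGraph n) → Dec (Acyclic G)
acyclic? {n} G = ¬? (any? λ v →
  map′ (λ { (_ , _ , vs , _ , c) → vs , c })
       (λ { (vs , c) → length vs , unique⇒length≤ (proj₁ (proj₂ c)) , vs , refl , c })
       (anyUpTo? (anyOfLength? (isCycle? G v)) n))

isTree? : (G : SimpleGraph n) → Dec (IsTree G)
isTree? G = connected? G ×-dec acyclic? G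

------------------------------------------------------------------------
-- Spanning trees

-- A subgraph of G containing all vertices of G amounts to a set of edges
-- of G, i.e. a subset of the positions in the list of edges.
spanningSubgraph : (G : SimpleGraph n) → Subset (length (edges G)) → SimpleGraph n
spanningSubgraph {n} G F = record
  { _~_   = λ u v → ∃[ e ] (e ∈ F × (lookup (edges G) e ≡ (u , v) ⊎ lookup (edges G) e ≡ (v , u)))
  ; _~?_  = λ u v → any? λ e → e ∈? F ×-dec (lookup (edges G) e ≟ (u , v) ⊎-dec lookup (edges G) e ≟ (v , u))
  ; ~-sym = λ (e , e∈F , p) → e , e∈F , Sum.swap p
  ; ~-irr = λ { refl (e , _ , p) → no-loop e (Sum.reduce p) }
  }
  where
  _≟_ = ≡-dec (Fin._≟_ {n}) (Fin._≟_ {n})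

  no-loop : ∀ e {u} → ¬ (lookup (edges G) e ≡ (u , u))
  no-loop e p with lookup (edges G) e
    | All.lookup (all-filter (isEdge? G) (cartesianProduct (allFin n) (allFin n)))
                 (∈-lookup {xs = edges G} e)
  no-loop e refl | _ | u<u , _ = <-irrefl refl u<u

subsets : ∀ m → List (Subset m)
subsets zero    = [] ∷ []
subsets (suc m) = cartesianProductWith _∷_ (outside ∷ inside ∷ []) (subsets m)

-- The number of spanning trees of G.  Since edges G and subsets m have no
-- repetitions, each spanning tree is counted exactly once.
τ : SimpleGraph n → ℕ
τ G = length (filter (isTree? ∘ spanningSubgraph G) (subsets (length (edges G))))

{-# OPTIONS --safe #-}

-- Orient every edge of G, and let R_v be the row of the incidence matrix at the vertex v, followed
-- by one more entry 1. Then ∣ R_v ∣² = 1 + d_v, so Hadamard's inequality bounds the norm of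
-- ⋀ R_v, i.e. the sum of the squares of all maximal minors, by ∏ (1 + d_v). The minor on the
-- edges of a spanning tree and the column of ones is ± n: adding one end of an edge to the other
-- contracts the edge and keeps the sum of the last column, until one vertex of weight n remains.
-- So every spanning tree contributes n² to the sum.
-- Hadamard's inequality is ∥ v ∧ a ∥² ≤ ∣ v ∣² ∥ a ∥², from the Clifford relation.

module Submission where

open import Defs
open import Data.Bool.Base using (Bool; true; false; if_then_else_)
open import Data.Fin.Base as Fin using (Fin; zero; suc; punchIn; punchOut)
open import Data.Fin.Properties
  using (_≟_; punchInᵢ≢i; punchIn-injective; punchIn-punchOut; punchOut-punchIn; punchOut-cong;
         any?; <-irrefl; <-asym; injective⇒≤)
open import Data.Fin.Subset using (Subset; inside; outside; _∈_)
open import Data.Fin.Subset.Properties using (_∈?_)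
open import Data.Integer.Base as ℤ using (ℤ; +_; 0ℤ; 1ℤ; -1ℤ; _+_; _*_; _-_; -_)
import Data.Integer.Properties as ℤ
open import Data.Integer.Tactic.RingSolver using (solve-∀)
open import Data.List.Base
  using (List; map; length; filter; lookup; tabulate; allFin; cartesianProduct)
  renaming ([] to []ˡ; _∷_ to infixr 5 _∷ˡ_; _∷ʳ_ to infixl 6 _∷ʳˡ_)
import Data.List.Membership.DecPropositional as DecMembership
open import Data.List.Membership.Propositional using () renaming (_∈_ to _∈ˡ_)
open import Data.List.Membership.Propositional.Properties using (∈-allFin; ∈-lookup; ∈-filter⁺; ∈-filter⁻)
open import Data.List.Membership.Setoid.Properties using (index-injective)
import Data.List.Properties as List
open import Data.List.Relation.Binary.Permutation.Propositional using (_↭_)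
open import Data.List.Relation.Binary.Permutation.Propositional.Properties using (map⁺)
open import Data.List.Relation.Unary.All as All using (All)
open import Data.List.Relation.Unary.All.Properties using (all-filter; ¬Any⇒All¬)
open import Data.List.Relation.Unary.AllPairs using (AllPairs)
open import Data.List.Relation.Unary.Any as Any using (Any)
open import Data.List.Relation.Unary.Linked using (Linked)
open import Data.List.Relation.Unary.Sorted.TotalOrder using (Sorted)
open import Data.List.Relation.Unary.Unique.Propositional using (Unique)
open import Data.List.Relation.Unary.Unique.Propositional.Properties
  using (allFin⁺; cartesianProduct⁺; filter⁺)
open import Data.Nat.Base as ℕ using (ℕ; zero; suc; NonZero; _^_; z≤n; s≤s)
open import Data.Nat.ListAction using (product)
open import Data.Nat.ListAction.Properties using (product-↭)
open import Data.Nat.Properties as ℕ using (≤-totalOrder; m^n≢0)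
open import Data.Product.Base using (∃-syntax; _×_; _,_; proj₁; proj₂)
open import Data.Product.Properties using (≡-dec)
open import Data.Rational.Base using (_/_; _≤_)
open import Data.Rational.Properties using (toℚᵘ-cancel-≤; toℚᵘ-fromℚᵘ)
open import Data.Rational.Unnormalised.Base as ℚᵘ using (mkℚᵘ; *≤*)
import Data.Rational.Unnormalised.Properties as ℚᵘ
open import Data.Sum.Base using (_⊎_; inj₁; inj₂)
open import Data.Vec.Base using ([]; _∷_; _∷ʳ_; here; there)
open import Data.Vec.Functional using (Vector; head; tail)
open import Function.Base using (_∘_)
open import Function.Bundles using (mk⇔)
open import Level using (0ℓ)
open import Relation.Binary.Construct.Closure.ReflexiveTransitive using (Star; ε; _◅_; _◅◅_)
open import Relation.Binary.Core using (Rel; _⇒_)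
open import Relation.Binary.Definitions using (Decidable)
open import Relation.Binary.PropositionalEquality
  using (_≡_; _≢_; _≗_; refl; sym; trans; cong; cong₂; subst; setoid; module ≡-Reasoning)
open import Relation.Nullary.Decidable using (yes; no; does; dec-true; dec-false; does-⇔; ¬?; _×-dec_; _⊎-dec_)
open import Relation.Nullary.Negation using (¬_; contradiction)
import Relation.Unary as Unary

open import Algebra.Properties.Semiring.Sum ℤ.+-*-semiring
  using (sum; sum-remove; ∑-distrib-+; *-distribʳ-sum; sum-replicate-zero)

private
  variable
    k m n : ℕ

-- Exterior algebra of ℤᵐ

-- a F is the coefficient of a at the wedge of the basis vectors e_i, i ∈ F.
Form : ℕ → Set
Form m = Subset m → ℤ

infixr 7 _∧_

-- Recursion on the first basis vector e₀: for v = x e₀ + v′ and a = aₒ + e₀ ∧ aᵢ the product is v′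
-- ∧ aₒ + e₀ ∧ (x aₒ - v′ ∧ aᵢ). The minus sign comes from moving v′ past e₀.
_∧_ : Vector ℤ m → Form m → Form m
(v ∧ a) []            = 0ℤ
(v ∧ a) (outside ∷ F) = (tail v ∧ (a ∘ (outside ∷_))) F
(v ∧ a) (inside  ∷ F) = head v * a (outside ∷ F) - (tail v ∧ (a ∘ (inside ∷_))) F

vacuum : Form m
vacuum []            = 1ℤ
vacuum (outside ∷ F) = vacuum F
vacuum (inside  ∷ F) = 0ℤ

-- The coefficient at F is, up to a global sign convention, the minor of the matrix with rows R on
-- the columns F if F has k elements, and 0 otherwise.
wedge : Vector (Vector ℤ m) k → Form m
wedge {k = zero}  R = vacuum
wedge {k = suc k} R = head R ∧ wedge (tail R)

∧-cong : ∀ {v w : Vector ℤ m} {a b} → v ≗ w → a ≗ b → v ∧ a ≗ w ∧ b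
∧-cong v≗w a≗b []            = refl
∧-cong v≗w a≗b (outside ∷ F) = ∧-cong (v≗w ∘ suc) (a≗b ∘ (outside ∷_)) F
∧-cong v≗w a≗b (inside  ∷ F) = cong₂ _-_ (cong₂ _*_ (v≗w zero) (a≗b (outside ∷ F)))
                                         (∧-cong (v≗w ∘ suc) (a≗b ∘ (inside ∷_)) F)

wedge-cong : ∀ {R S : Vector (Vector ℤ m) k} → (∀ i → R i ≗ S i) → wedge R ≗ wedge S
wedge-cong {k = zero}  R≗S F = refl
wedge-cong {k = suc k} R≗S F = ∧-cong (R≗S zero) (wedge-cong (R≗S ∘ suc)) F

∧-scaleʳ : ∀ s (v : Vector ℤ m) a F → (v ∧ λ E → s * a E) F ≡ s * (v ∧ a) F
∧-scaleʳ s v a []            = sym (ℤ.*-zeroʳ s)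
∧-scaleʳ s v a (outside ∷ F) = ∧-scaleʳ s (tail v) (a ∘ (outside ∷_)) F
∧-scaleʳ s v a (inside  ∷ F)
  rewrite ∧-scaleʳ s (tail v) (a ∘ (inside ∷_)) F = lemma s (head v) _ _
  where
  lemma : ∀ s x p q → x * (s * p) - s * q ≡ s * (x * p - q)
  lemma = solve-∀

∧-linearʳ : ∀ s (v : Vector ℤ m) a b F →
            (v ∧ λ E → s * a E - b E) F ≡ s * (v ∧ a) F - (v ∧ b) F
∧-linearʳ s v a b []            = sym (cong (_- 0ℤ) (ℤ.*-zeroʳ s))
∧-linearʳ s v a b (outside ∷ F) = ∧-linearʳ s (tail v) (a ∘ (outside ∷_)) (b ∘ (outside ∷_)) F
∧-linearʳ s v a b (inside  ∷ F)
  rewrite ∧-linearʳ s (tail v) (a ∘ (inside ∷_)) (b ∘ (inside ∷_)) F = lemma s (head v) _ _ _ _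
  where
  lemma : ∀ s x p q p′ q′ → x * (s * p - q) - (s * p′ - q′) ≡ s * (x * p - p′) - (x * q - q′)
  lemma = solve-∀

∧-linearˡ : ∀ s (u v : Vector ℤ m) a F →
            ((λ e → u e + s * v e) ∧ a) F ≡ (u ∧ a) F + s * (v ∧ a) F
∧-linearˡ s u v a []            = sym (trans (ℤ.+-identityˡ _) (ℤ.*-zeroʳ s))
∧-linearˡ s u v a (outside ∷ F) = ∧-linearˡ s (tail u) (tail v) (a ∘ (outside ∷_)) F
∧-linearˡ s u v a (inside  ∷ F)
  rewrite ∧-linearˡ s (tail u) (tail v) (a ∘ (inside ∷_)) F = lemma s (head u) (head v) _ _ _
  where
  lemma : ∀ s x y p q q′ → (x + s * y) * p - (q + s * q′) ≡ (x * p - q) + s * (y * p - q′)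
  lemma = solve-∀

∧-self : ∀ (v : Vector ℤ m) a F → (v ∧ v ∧ a) F ≡ 0ℤ
∧-self v a []            = refl
∧-self v a (outside ∷ F) = ∧-self (tail v) (a ∘ (outside ∷_)) F
∧-self v a (inside  ∷ F)
  rewrite ∧-linearʳ (head v) (tail v) (a ∘ (outside ∷_)) (tail v ∧ (a ∘ (inside ∷_))) F
        | ∧-self (tail v) (a ∘ (inside ∷_)) F = lemma (head v * _)
  where
  lemma : ∀ p → p - (p - 0ℤ) ≡ 0ℤ
  lemma = solve-∀

∧-anticomm : ∀ (v w : Vector ℤ m) a F → (v ∧ w ∧ a) F ≡ - (w ∧ v ∧ a) F
∧-anticomm v w a []            = refl
∧-anticomm v w a (outside ∷ F) = ∧-anticomm (tail v) (tail w) (a ∘ (outside ∷_)) F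
∧-anticomm v w a (inside  ∷ F)
  rewrite ∧-linearʳ (head w) (tail v) (a ∘ (outside ∷_)) (tail w ∧ (a ∘ (inside ∷_))) F
        | ∧-linearʳ (head v) (tail w) (a ∘ (outside ∷_)) (tail v ∧ (a ∘ (inside ∷_))) F
        | ∧-anticomm (tail v) (tail w) (a ∘ (inside ∷_)) F = lemma (head v * _) (head w * _) _
  where
  lemma : ∀ p q r → p - (q - - r) ≡ - (q - (p - r))
  lemma = solve-∀

-- The row operations of Gaussian elimination. By anticommutativity v is carried past each factor in
-- turn; the multiple of v added to that factor then meets v and dies by `∧-self`.
∧-wedge-shear : ∀ (v : Vector ℤ m) (c : Vector ℤ k) (U : Vector (Vector ℤ m) k) →
                v ∧ wedge (λ l e → U l e + c l * v e) ≗ v ∧ wedge U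
∧-wedge-shear {k = zero}  v c U F = refl
∧-wedge-shear {k = suc k} v c U F = begin
  (v ∧ u′ ∧ wedge (tail U′)) F                      ≡⟨ ∧-anticomm v u′ _ F ⟩
  - (u′ ∧ v ∧ wedge (tail U′)) F                    ≡⟨ cong -_ (∧-cong (λ _ → refl) (∧-wedge-shear v (tail c) (tail U)) F) ⟩
  - (u′ ∧ v ∧ wedge (tail U)) F                     ≡⟨ cong -_ (∧-linearˡ (head c) (head U) v _ F) ⟩
  - ((head U ∧ v ∧ wedge (tail U)) F + head c * (v ∧ v ∧ wedge (tail U)) F)
    ≡⟨ cong (λ z → - ((head U ∧ v ∧ wedge (tail U)) F + head c * z)) (∧-self v (wedge (tail U)) F) ⟩
  - ((head U ∧ v ∧ wedge (tail U)) F + head c * 0ℤ) ≡⟨ cong -_ (lemma _ (head c)) ⟩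
  - (head U ∧ v ∧ wedge (tail U)) F                 ≡⟨ ∧-anticomm v (head U) _ F ⟨
  (v ∧ head U ∧ wedge (tail U)) F                   ∎
  where
  open ≡-Reasoning
  U′ = λ l e → U l e + c l * v e
  lemma : ∀ p s → p + s * 0ℤ ≡ p
  lemma = solve-∀
  u′ = head U′

-- Row i passes the i rows before it, each at the cost of a sign. Only s * s ≡ 1 is recorded,
-- because minors enter the final sum squared.
wedge-moveToFront : ∀ (R : Vector (Vector ℤ m) (suc k)) i →
  ∃[ s ] (s * s ≡ 1ℤ × ∀ F → wedge R F ≡ s * (R i ∧ wedge (R ∘ punchIn i)) F)
wedge-moveToFront R zero = 1ℤ , refl , λ F → sym (ℤ.*-identityˡ _)
wedge-moveToFront {k = suc k} R (suc i) with wedge-moveToFront (tail R) i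
... | s , s²≡1 , eq = - s , trans (lemma₁ s) s²≡1 , λ F → begin
  (head R ∧ wedge (tail R)) F                                          ≡⟨ ∧-cong (λ _ → refl) eq F ⟩
  (head R ∧ λ E → s * (R (suc i) ∧ wedge (tail R ∘ punchIn i)) E) F     ≡⟨ ∧-scaleʳ s (head R) _ F ⟩
  s * (head R ∧ R (suc i) ∧ wedge (tail R ∘ punchIn i)) F               ≡⟨ cong (s *_) (∧-anticomm (head R) (R (suc i)) _ F) ⟩
  s * - (R (suc i) ∧ head R ∧ wedge (tail R ∘ punchIn i)) F             ≡⟨ lemma₂ s _ ⟩
  - s * (R (suc i) ∧ head R ∧ wedge (tail R ∘ punchIn i)) F             ∎
  where
  open ≡-Reasoning
  lemma₁ : ∀ s → - s * - s ≡ s * s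
  lemma₁ = solve-∀
  lemma₂ : ∀ s x → s * - x ≡ - s * x
  lemma₂ = solve-∀

-- A minor that avoids the first column does not see it. This deletes edges outside a tree and
-- columns already cleared by elimination.
wedge-outside : ∀ (R : Vector (Vector ℤ (suc m)) k) F → wedge R (outside ∷ F) ≡ wedge (tail ∘ R) F
wedge-outside {k = zero}  R F = refl
wedge-outside {k = suc k} R F = ∧-cong (λ _ → refl) (wedge-outside (tail R)) F

∧-zeroʳ : ∀ (v : Vector ℤ m) a → (∀ F → a F ≡ 0ℤ) → ∀ F → (v ∧ a) F ≡ 0ℤ
∧-zeroʳ v a a≡0 []            = refl
∧-zeroʳ v a a≡0 (outside ∷ F) = ∧-zeroʳ (tail v) _ (a≡0 ∘ (outside ∷_)) F
∧-zeroʳ v a a≡0 (inside  ∷ F)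
  rewrite a≡0 (outside ∷ F) | ∧-zeroʳ (tail v) _ (a≡0 ∘ (inside ∷_)) F = cong (_- 0ℤ) (ℤ.*-zeroʳ (head v))

wedge-zeroColumn : ∀ (R : Vector (Vector ℤ (suc m)) k) → (∀ i → head (R i) ≡ 0ℤ) →
                   ∀ F → wedge R (inside ∷ F) ≡ 0ℤ
wedge-zeroColumn {k = zero}  R R₀≡0 F = refl
wedge-zeroColumn {k = suc k} R R₀≡0 F
  rewrite R₀≡0 zero | ∧-zeroʳ (tail (head R)) _ (wedge-zeroColumn (tail R) (R₀≡0 ∘ suc)) F = refl

-- Sums over subsets and Hadamard's inequality

∑ : (Subset m → ℤ) → ℤ
∑ {zero}  f = f []
∑ {suc m} f = ∑ (f ∘ (outside ∷_)) + ∑ (f ∘ (inside ∷_))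

∑-cong : ∀ {f g : Subset m → ℤ} → f ≗ g → ∑ f ≡ ∑ g
∑-cong {zero}  f≗g = f≗g []
∑-cong {suc m} f≗g = cong₂ _+_ (∑-cong (f≗g ∘ (outside ∷_))) (∑-cong (f≗g ∘ (inside ∷_)))

∑-+ : ∀ (f g : Subset m → ℤ) → ∑ (λ F → f F + g F) ≡ ∑ f + ∑ g
∑-+ {zero}  f g = refl
∑-+ {suc m} f g
  rewrite ∑-+ (f ∘ (outside ∷_)) (g ∘ (outside ∷_)) | ∑-+ (f ∘ (inside ∷_)) (g ∘ (inside ∷_)) =
  lemma (∑ (f ∘ (outside ∷_))) (∑ (g ∘ (outside ∷_))) (∑ (f ∘ (inside ∷_))) (∑ (g ∘ (inside ∷_)))
  where
  lemma : ∀ a b c d → (a + b) + (c + d) ≡ (a + c) + (b + d)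
  lemma = solve-∀

∑-* : ∀ s (f : Subset m → ℤ) → ∑ (λ F → s * f F) ≡ s * ∑ f
∑-* {zero}  s f = refl
∑-* {suc m} s f
  rewrite ∑-* s (f ∘ (outside ∷_)) | ∑-* s (f ∘ (inside ∷_)) = 
  sym (ℤ.*-distribˡ-+ s (∑ (f ∘ (outside ∷_))) (∑ (f ∘ (inside ∷_))))

⟨_,_⟩ : Form m → Form m → ℤ
⟨ a , b ⟩ = ∑ λ F → a F * b F

⟨⟩-linearˡ : ∀ s (a b c : Form m) → ⟨ (λ F → s * a F + b F) , c ⟩ ≡ s * ⟨ a , c ⟩ + ⟨ b , c ⟩
⟨⟩-linearˡ s a b c = begin
  ∑ (λ F → (s * a F + b F) * c F)        ≡⟨ ∑-cong (λ F → lemma s (a F) (b F) (c F)) ⟩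
  ∑ (λ F → s * (a F * c F) + b F * c F)  ≡⟨ ∑-+ (λ F → s * (a F * c F)) (λ F → b F * c F) ⟩
  ∑ (λ F → s * (a F * c F)) + ⟨ b , c ⟩  ≡⟨ cong (_+ ⟨ b , c ⟩) (∑-* s (λ F → a F * c F)) ⟩
  s * ⟨ a , c ⟩ + ⟨ b , c ⟩              ∎
  where
  open ≡-Reasoning
  lemma : ∀ s a b c → (s * a + b) * c ≡ s * (a * c) + b * c
  lemma = solve-∀

⟨⟩-sym : ∀ (a b : Form m) → ⟨ a , b ⟩ ≡ ⟨ b , a ⟩
⟨⟩-sym a b = ∑-cong λ F → ℤ.*-comm (a F) (b F)

⟨⟩-negˡ : ∀ (a b : Form m) → ⟨ (λ F → - a F) , b ⟩ ≡ - ⟨ a , b ⟩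
⟨⟩-negˡ a b = begin
  ∑ (λ F → - a F * b F)        ≡⟨ ∑-cong (λ F → lemma (a F) (b F)) ⟩
  ∑ (λ F → -1ℤ * (a F * b F))  ≡⟨ ∑-* -1ℤ (λ F → a F * b F) ⟩
  -1ℤ * ⟨ a , b ⟩              ≡⟨ ℤ.-1*i≡-i _ ⟩
  - ⟨ a , b ⟩                  ∎
  where
  open ≡-Reasoning
  lemma : ∀ a b → - a * b ≡ -1ℤ * (a * b)
  lemma = solve-∀

∥_∥² : Form m → ℤ
∥ a ∥² = ⟨ a , a ⟩

∥∥²-combination : ∀ s (a b : Form m) →
  ∥ (λ F → s * a F + b F) ∥² ≡ s * s * ∥ a ∥² + (+ 2) * s * ⟨ a , b ⟩ + ∥ b ∥²
∥∥²-combination s a b = begin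
  ⟨ c , c ⟩
    ≡⟨ ⟨⟩-linearˡ s a b c ⟩
  s * ⟨ a , c ⟩ + ⟨ b , c ⟩
    ≡⟨ cong₂ (λ p q → s * p + q) (⟨⟩-sym a c) (⟨⟩-sym b c) ⟩
  s * ⟨ c , a ⟩ + ⟨ c , b ⟩
    ≡⟨ cong₂ (λ p q → s * p + q) (⟨⟩-linearˡ s a b a) (⟨⟩-linearˡ s a b b) ⟩
  s * (s * ⟨ a , a ⟩ + ⟨ b , a ⟩) + (s * ⟨ a , b ⟩ + ⟨ b , b ⟩)
    ≡⟨ cong (λ p → s * (s * ⟨ a , a ⟩ + p) + (s * ⟨ a , b ⟩ + ⟨ b , b ⟩)) (⟨⟩-sym b a) ⟩
  s * (s * ⟨ a , a ⟩ + ⟨ a , b ⟩) + (s * ⟨ a , b ⟩ + ⟨ b , b ⟩)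
    ≡⟨ lemma s ⟨ a , a ⟩ ⟨ a , b ⟩ ⟨ b , b ⟩ ⟩
  s * s * ⟨ a , a ⟩ + (+ 2) * s * ⟨ a , b ⟩ + ⟨ b , b ⟩ ∎
  where
  open ≡-Reasoning
  c = λ F → s * a F + b F
  lemma : ∀ s p q r → s * (s * p + q) + (s * q + r) ≡ s * s * p + (+ 2) * s * q + r
  lemma = solve-∀

∥∥²-nonneg : ∀ (a : Form m) → 0ℤ ℤ.≤ ∥ a ∥²
∥∥²-nonneg {zero}  a with a []
... | + i      rewrite sym (ℤ.pos-* i i) = ℤ.+≤+ z≤n
... | ℤ.-[1+ i ] = ℤ.+≤+ z≤n
∥∥²-nonneg {suc m} a = ℤ.+-mono-≤ (∥∥²-nonneg (a ∘ (outside ∷_))) (∥∥²-nonneg (a ∘ (inside ∷_)))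

-- The interior product: contraction by e₀ strips e₀ from e₀ ∧ aᵢ, while v′ changes sign when it is
-- moved past e₀.
_⌟_ : Vector ℤ m → Form m → Form m
(v ⌟ a) []            = 0ℤ
(v ⌟ a) (outside ∷ F) = head v * a (inside ∷ F) + (tail v ⌟ (a ∘ (outside ∷_))) F
(v ⌟ a) (inside  ∷ F) = - (tail v ⌟ (a ∘ (inside ∷_))) F

⌟-adjoint : ∀ (v : Vector ℤ m) a b → ⟨ v ⌟ a , b ⟩ ≡ ⟨ a , v ∧ b ⟩
⌟-adjoint {zero}  v a b = sym (ℤ.*-zeroʳ (a []))
⌟-adjoint {suc m} v a b = begin
  ⟨ (λ F → x * aᵢ F + (v′ ⌟ aₒ) F) , bₒ ⟩ + ⟨ (λ F → - (v′ ⌟ aᵢ) F) , bᵢ ⟩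
    ≡⟨ cong₂ _+_ (⟨⟩-linearˡ x aᵢ (v′ ⌟ aₒ) bₒ) (⟨⟩-negˡ (v′ ⌟ aᵢ) bᵢ) ⟩
  x * ⟨ aᵢ , bₒ ⟩ + ⟨ v′ ⌟ aₒ , bₒ ⟩ + - ⟨ v′ ⌟ aᵢ , bᵢ ⟩
    ≡⟨ cong₂ (λ p q → x * ⟨ aᵢ , bₒ ⟩ + p + - q) (⌟-adjoint v′ aₒ bₒ) (⌟-adjoint v′ aᵢ bᵢ) ⟩
  x * ⟨ aᵢ , bₒ ⟩ + ⟨ aₒ , v′ ∧ bₒ ⟩ + - ⟨ aᵢ , v′ ∧ bᵢ ⟩
    ≡⟨ lemma (x * ⟨ aᵢ , bₒ ⟩) _ _ ⟩
  ⟨ aₒ , v′ ∧ bₒ ⟩ + (x * ⟨ aᵢ , bₒ ⟩ + - ⟨ aᵢ , v′ ∧ bᵢ ⟩)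
    ≡⟨ cong (λ p → ⟨ aₒ , v′ ∧ bₒ ⟩ + p) (cong₂ (λ p q → x * p + - q) (⟨⟩-sym aᵢ bₒ) (⟨⟩-sym aᵢ _)) ⟩
  ⟨ aₒ , v′ ∧ bₒ ⟩ + (x * ⟨ bₒ , aᵢ ⟩ + - ⟨ v′ ∧ bᵢ , aᵢ ⟩)
    ≡⟨ cong (λ p → ⟨ aₒ , v′ ∧ bₒ ⟩ + (x * ⟨ bₒ , aᵢ ⟩ + p)) (⟨⟩-negˡ (v′ ∧ bᵢ) aᵢ) ⟨
  ⟨ aₒ , v′ ∧ bₒ ⟩ + (x * ⟨ bₒ , aᵢ ⟩ + ⟨ (λ F → - (v′ ∧ bᵢ) F) , aᵢ ⟩)
    ≡⟨ cong (λ p → ⟨ aₒ , v′ ∧ bₒ ⟩ + p) (trans (⟨⟩-sym aᵢ _) (⟨⟩-linearˡ x bₒ _ aᵢ)) ⟨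
  ⟨ aₒ , v′ ∧ bₒ ⟩ + ⟨ aᵢ , (λ F → x * bₒ F - (v′ ∧ bᵢ) F) ⟩ ∎
  where
  open ≡-Reasoning
  x = head v
  v′ = tail v
  aₒ = a ∘ (outside ∷_)
  aᵢ = a ∘ (inside ∷_)
  bₒ = b ∘ (outside ∷_)
  bᵢ = b ∘ (inside ∷_)
  lemma : ∀ p q r → p + q + - r ≡ q + (p + - r)
  lemma = solve-∀

∣_∣² : Vector ℤ m → ℤ
∣_∣² {zero}  v = 0ℤ
∣_∣² {suc m} v = head v * head v + ∣ tail v ∣²

-- The Clifford relation v ∧ (v ⌟ a) + v ⌟ (v ∧ a) = ∣ v ∣² a, paired with a.
∥∧∥²+∥⌟∥² : ∀ (v : Vector ℤ m) a → ∥ v ∧ a ∥² + ∥ v ⌟ a ∥² ≡ ∣ v ∣² * ∥ a ∥²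
∥∧∥²+∥⌟∥² {zero}  v a = refl
∥∧∥²+∥⌟∥² {suc m} v a = begin
  ∥ v′ ∧ aₒ ∥² + ∥ (λ F → x * aₒ F - (v′ ∧ aᵢ) F) ∥² + (∥ (λ F → x * aᵢ F + (v′ ⌟ aₒ) F) ∥² + ∥ (λ F → - (v′ ⌟ aᵢ) F) ∥²)
    ≡⟨ cong₂ (λ p q → ∥ v′ ∧ aₒ ∥² + p + q) eq₁ (cong₂ _+_ eq₂ (neg² (v′ ⌟ aᵢ))) ⟩
  ∥ v′ ∧ aₒ ∥² + (x * x * ∥ aₒ ∥² + (+ 2) * x * - ⟨ aₒ , v′ ∧ aᵢ ⟩ + ∥ v′ ∧ aᵢ ∥²)
    + (x * x * ∥ aᵢ ∥² + (+ 2) * x * ⟨ aₒ , v′ ∧ aᵢ ⟩ + ∥ v′ ⌟ aₒ ∥² + ∥ v′ ⌟ aᵢ ∥²)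
    -- By adjointness both cross terms are multiples of ⟨ aₒ , v′ ∧ aᵢ ⟩ with opposite signs, so
    -- they cancel; the rest regroups into the induction hypotheses for aₒ and aᵢ.
    ≡⟨ lemma₁ (∥ v′ ∧ aₒ ∥²) (∥ v′ ∧ aᵢ ∥²) (∥ v′ ⌟ aₒ ∥²) (∥ v′ ⌟ aᵢ ∥²) x (⟨ aₒ , v′ ∧ aᵢ ⟩) (∥ aₒ ∥²) (∥ aᵢ ∥²) ⟩
  x * x * (∥ aₒ ∥² + ∥ aᵢ ∥²) + ((∥ v′ ∧ aₒ ∥² + ∥ v′ ⌟ aₒ ∥²) + (∥ v′ ∧ aᵢ ∥² + ∥ v′ ⌟ aᵢ ∥²))
    ≡⟨ cong (λ p → x * x * (∥ aₒ ∥² + ∥ aᵢ ∥²) + p) (cong₂ _+_ (∥∧∥²+∥⌟∥² v′ aₒ) (∥∧∥²+∥⌟∥² v′ aᵢ)) ⟩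
  x * x * (∥ aₒ ∥² + ∥ aᵢ ∥²) + (∣ v′ ∣² * ∥ aₒ ∥² + ∣ v′ ∣² * ∥ aᵢ ∥²)
    ≡⟨ lemma₂ x (∣ v′ ∣²) (∥ aₒ ∥²) (∥ aᵢ ∥²) ⟩
  (x * x + ∣ v′ ∣²) * (∥ aₒ ∥² + ∥ aᵢ ∥²) ∎
  where
  open ≡-Reasoning
  x = head v
  v′ = tail v
  aₒ = a ∘ (outside ∷_)
  aᵢ = a ∘ (inside ∷_)
  neg² : ∀ (b : Form m) → ∥ (λ F → - b F) ∥² ≡ ∥ b ∥²
  neg² b = ∑-cong λ F → lemma (b F)
    where
    lemma : ∀ p → - p * - p ≡ p * p
    lemma = solve-∀
  eq₁ : ∥ (λ F → x * aₒ F - (v′ ∧ aᵢ) F) ∥² ≡ x * x * ∥ aₒ ∥² + (+ 2) * x * - ⟨ aₒ , v′ ∧ aᵢ ⟩ + ∥ v′ ∧ aᵢ ∥²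
  eq₁ = trans (∥∥²-combination x aₒ _)
    (cong₂ (λ p q → x * x * ∥ aₒ ∥² + (+ 2) * x * p + q)
      (trans (⟨⟩-sym aₒ _) (trans (⟨⟩-negˡ (v′ ∧ aᵢ) aₒ) (cong -_ (⟨⟩-sym (v′ ∧ aᵢ) aₒ)))) (neg² (v′ ∧ aᵢ)))
  eq₂ : ∥ (λ F → x * aᵢ F + (v′ ⌟ aₒ) F) ∥² ≡ x * x * ∥ aᵢ ∥² + (+ 2) * x * ⟨ aₒ , v′ ∧ aᵢ ⟩ + ∥ v′ ⌟ aₒ ∥²
  eq₂ = trans (∥∥²-combination x aᵢ _)
    (cong (λ p → x * x * ∥ aᵢ ∥² + (+ 2) * x * p + ∥ v′ ⌟ aₒ ∥²)
      (trans (⟨⟩-sym aᵢ _) (⌟-adjoint v′ aₒ aᵢ)))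
  lemma₁ : ∀ A B C D x i p q →
    A + (x * x * p + (+ 2) * x * - i + B) + (x * x * q + (+ 2) * x * i + C + D) ≡
    x * x * (p + q) + ((A + C) + (B + D))
  lemma₁ = solve-∀
  lemma₂ : ∀ x w p q → x * x * (p + q) + (w * p + w * q) ≡ (x * x + w) * (p + q)
  lemma₂ = solve-∀

∑-0 : ∀ m → ∑ {m} (λ _ → 0ℤ) ≡ 0ℤ
∑-0 zero    = refl
∑-0 (suc m) = cong₂ _+_ (∑-0 m) (∑-0 m)

∥vacuum∥² : ∀ m → ∥ vacuum {m} ∥² ≡ 1ℤ
∥vacuum∥² zero    = refl
∥vacuum∥² (suc m) = cong₂ _+_ (∥vacuum∥² m) (∑-0 m)

-- By Cauchy-Binet the left side is the Gram determinant of the rows. Rows are split off one at a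
-- time, each contributing at most its squared norm. Natural upper bounds c in place of the norms
-- keep the product in ℕ.
hadamard : ∀ (R : Vector (Vector ℤ m) k) (c : Vector ℕ k) → (∀ i → ∣ R i ∣² ℤ.≤ + c i) →
           ∥ wedge R ∥² ℤ.≤ + product (tabulate c)
hadamard {m} {zero} R c R≤c = ℤ.≤-reflexive (∥vacuum∥² m)
hadamard {m} {suc k} R c R≤c = begin
  ∥ v ∧ a ∥²                               ≤⟨ ℤ.i≤i+j _ _ {{ℤ.nonNegative (∥∥²-nonneg (v ⌟ a))}} ⟩
  ∥ v ∧ a ∥² + ∥ v ⌟ a ∥²                  ≡⟨ ∥∧∥²+∥⌟∥² v a ⟩
  ∣ v ∣² * ∥ a ∥²                          ≤⟨ ℤ.*-monoʳ-≤-nonNeg _ {{ℤ.nonNegative (∥∥²-nonneg a)}} (R≤c zero) ⟩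
  + head c * ∥ a ∥²                        ≤⟨ ℤ.*-monoˡ-≤-nonNeg (+ head c) (hadamard (tail R) (tail c) (R≤c ∘ suc)) ⟩
  + head c * + product (tabulate (tail c)) ≡⟨ ℤ.pos-* (head c) _ ⟨
  + product (tabulate c)                   ∎
  where
  open ℤ.≤-Reasoning
  v = head R
  a = wedge (tail R)

-- `∑` splits along the first element, but the column of ones is the last; this isolates the minors
-- that use it.
∑-∷ʳ : ∀ (f : Subset (suc m) → ℤ) → ∑ f ≡ ∑ (f ∘ (_∷ʳ outside)) + ∑ (f ∘ (_∷ʳ inside))
∑-∷ʳ {zero}  f = refl
∑-∷ʳ {suc m} f
  rewrite ∑-∷ʳ (f ∘ (outside ∷_)) | ∑-∷ʳ (f ∘ (inside ∷_)) =
  lemma (∑ (f ∘ (outside ∷_) ∘ (_∷ʳ outside))) (∑ (f ∘ (outside ∷_) ∘ (_∷ʳ inside)))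
        (∑ (f ∘ (inside ∷_) ∘ (_∷ʳ outside))) (∑ (f ∘ (inside ∷_) ∘ (_∷ʳ inside)))
  where
  lemma : ∀ p q r s → (p + q) + (r + s) ≡ (p + r) + (q + s)
  lemma = solve-∀

length-filter-map : ∀ {A B : Set} {P : Unary.Pred B 0ℓ} (P? : Unary.Decidable P) (f : A → B) xs →
                    length (filter P? (map f xs)) ≡ length (filter (P? ∘ f) xs)
length-filter-map P? f []ˡ = refl
length-filter-map P? f (x ∷ˡ xs) with does (P? (f x))
... | true  = cong suc (length-filter-map P? f xs)
... | false = length-filter-map P? f xs

length-filter-subsets : ∀ {P : Unary.Pred (Subset (suc m)) 0ℓ} (P? : Unary.Decidable P) →
  length (filter P? (subsets (suc m))) ≡
  length (filter (P? ∘ (outside ∷_)) (subsets m)) ℕ.+ length (filter (P? ∘ (inside ∷_)) (subsets m))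
length-filter-subsets {m} P?
  rewrite List.++-identityʳ (map (inside ∷_) (subsets m))
        | List.filter-++ P? (map (outside ∷_) (subsets m)) (map (inside ∷_) (subsets m))
        | List.length-++ (filter P? (map (outside ∷_) (subsets m))) {filter P? (map (inside ∷_) (subsets m))}
  = cong₂ ℕ._+_ (length-filter-map P? (outside ∷_) (subsets m)) (length-filter-map P? (inside ∷_) (subsets m))

-- Markov's inequality for the counting measure on subsets.
length-filter-subsets-≤ : ∀ {P : Unary.Pred (Subset m) 0ℓ} (P? : Unary.Decidable P) (f : Subset m → ℤ) c →
  (∀ F → 0ℤ ℤ.≤ f F) → (∀ F → P F → c ℤ.≤ f F) → + length (filter P? (subsets m)) * c ℤ.≤ ∑ f
length-filter-subsets-≤ {zero} P? f c 0≤f c≤f with P? []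
... | yes p = ℤ.≤-trans (ℤ.≤-reflexive (ℤ.*-identityˡ c)) (c≤f [] p)
... | no  _ = 0≤f []
length-filter-subsets-≤ {suc m} P? f c 0≤f c≤f = begin
  + length (filter P? (subsets (suc m))) * c ≡⟨ cong (λ z → + z * c) (length-filter-subsets P?) ⟩
  (+ l₁ + + l₂) * c                          ≡⟨ ℤ.*-distribʳ-+ c (+ l₁) (+ l₂) ⟩
  + l₁ * c + + l₂ * c                        ≤⟨ ℤ.+-mono-≤ (ih outside) (ih inside) ⟩
  ∑ f                                        ∎
  where
  open ℤ.≤-Reasoning
  l₁ = length (filter (P? ∘ (outside ∷_)) (subsets m))
  l₂ = length (filter (P? ∘ (inside ∷_)) (subsets m))
  ih = λ s → length-filter-subsets-≤ (P? ∘ (s ∷_)) (f ∘ (s ∷_)) c (0≤f ∘ (s ∷_)) (c≤f ∘ (s ∷_))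

-- Minors of incidence matrices

-- Through `does`, δ (suc i) (suc l) reduces to δ i l.
δ : Fin k → Fin k → ℤ
δ i l = if does (i ≟ l) then 1ℤ else 0ℤ

δ-≡ : ∀ (i : Fin k) → δ i i ≡ 1ℤ
δ-≡ i = cong (if_then 1ℤ else 0ℤ) (dec-true (i ≟ i) refl)

δ-≢ : ∀ {i l : Fin k} → i ≢ l → δ i l ≡ 0ℤ
δ-≢ {i = i} {l} i≢l = cong (if_then 1ℤ else 0ℤ) (dec-false (i ≟ l) i≢l)

δ-punchIn : ∀ (i : Fin (suc k)) j l → δ (punchIn i j) (punchIn i l) ≡ δ j l
δ-punchIn i j l = cong (if_then 1ℤ else 0ℤ)
  (does-⇔ (mk⇔ (punchIn-injective i j l) (cong (punchIn i))) (punchIn i j ≟ punchIn i l) (j ≟ l))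

sum-δ : ∀ (i : Fin k) → sum (δ i) ≡ 1ℤ
sum-δ {suc k} zero = cong (λ z → 1ℤ + z) (sum-replicate-zero k)
sum-δ (suc i) = trans (ℤ.+-identityˡ _) (sum-δ i)

-- The quotient map that merges i into j; `punchIn i` is a section of it.
contract : ∀ {i j : Fin (suc k)} → i ≢ j → Fin (suc k) → Fin k
contract {i = i} i≢j a with i ≟ a
... | yes _   = punchOut i≢j
... | no  i≢a = punchOut i≢a

-- A function that agrees at i and j descends along `contract`, namely to `x ∘ punchIn i`.
punchIn-contract : ∀ {A : Set} {i j : Fin (suc k)} (i≢j : i ≢ j) (x : Fin (suc k) → A) → x i ≡ x j →
                   ∀ a → x (punchIn i (contract i≢j a)) ≡ x a
punchIn-contract {i = i} i≢j x xᵢ≡xⱼ a with i ≟ a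
... | yes refl = trans (cong x (punchIn-punchOut i≢j)) (sym xᵢ≡xⱼ)
... | no  i≢a  = cong x (punchIn-punchOut i≢a)

contract-punchIn : ∀ {i j : Fin (suc k)} (i≢j : i ≢ j) l → contract i≢j (punchIn i l) ≡ l
contract-punchIn {i = i} i≢j l with i ≟ punchIn i l
... | yes i≡ = contradiction (sym i≡) (punchInᵢ≢i i l)
... | no  i≢ = trans (punchOut-cong i refl) (punchOut-punchIn i)

contract-identifies : ∀ {i j : Fin (suc k)} (i≢j : i ≢ j) → contract i≢j i ≡ contract i≢j j
contract-identifies {i = i} {j} i≢j with i ≟ i | i ≟ j
... | no  i≢i | _       = contradiction refl i≢i
... | yes _   | yes i≡j = contradiction i≡j i≢j
... | yes _   | no  _   = punchOut-cong i refl

-- Merging i into j adds entry i of an indicator vector to entry j and deletes entry i. Hence adding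
-- row i to row j of an incidence matrix amounts to contraction.
δ-contract : ∀ {i j : Fin (suc k)} (i≢j : i ≢ j) a l →
             δ (contract i≢j a) l ≡ δ a (punchIn i l) + δ j (punchIn i l) * δ a i
δ-contract {i = i} {j} i≢j a l with i ≟ a
... | yes refl = begin
  δ (punchOut i≢j) l                              ≡⟨ δ-punchIn i _ l ⟨
  δ (punchIn i (punchOut i≢j)) (punchIn i l)      ≡⟨ cong (λ z → δ z (punchIn i l)) (punchIn-punchOut i≢j) ⟩
  δ j (punchIn i l)                               ≡⟨ lemma _ ⟨
  0ℤ + δ j (punchIn i l) * 1ℤ                     ≡⟨ cong₂ (λ p q → p + δ j (punchIn i l) * q) (δ-≢ (punchInᵢ≢i i l ∘ sym)) (δ-≡ i) ⟨
  δ i (punchIn i l) + δ j (punchIn i l) * δ i i   ∎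
  where
  open ≡-Reasoning
  lemma : ∀ p → 0ℤ + p * 1ℤ ≡ p
  lemma = solve-∀
... | no i≢a = begin
  δ (punchOut i≢a) l                              ≡⟨ δ-punchIn i _ l ⟨
  δ (punchIn i (punchOut i≢a)) (punchIn i l)      ≡⟨ cong (λ z → δ z (punchIn i l)) (punchIn-punchOut i≢a) ⟩
  δ a (punchIn i l)                               ≡⟨ lemma _ (δ j (punchIn i l)) ⟨
  δ a (punchIn i l) + δ j (punchIn i l) * 0ℤ      ≡⟨ cong (λ q → δ a (punchIn i l) + δ j (punchIn i l) * q) (δ-≢ (i≢a ∘ sym)) ⟨
  δ a (punchIn i l) + δ j (punchIn i l) * δ a i   ∎
  where
  open ≡-Reasoning
  lemma : ∀ p q → p + q * 0ℤ ≡ p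
  lemma = solve-∀

append : ∀ {A : Set} → Vector A m → A → Vector A (suc m)
append {zero}  f a _       = a
append {suc m} f a zero    = head f
append {suc m} f a (suc e) = append (tail f) a e

append-combination : ∀ (f g h : Vector ℤ m) a b {c} s → (∀ e → f e + s * g e ≡ h e) → a + s * b ≡ c →
                     ∀ e → append f a e + s * append g b e ≡ append h c e
append-combination {zero}  f g h a b s f+sg≡h a+sb≡c zero    = a+sb≡c
append-combination {suc m} f g h a b s f+sg≡h a+sb≡c zero    = f+sg≡h zero
append-combination {suc m} f g h a b s f+sg≡h a+sb≡c (suc e) =
  append-combination (tail f) (tail g) (tail h) a b s (f+sg≡h ∘ suc) a+sb≡c e

-- Multigraphs with loops and parallel edges, since contraction can produce both.
Edges : ℕ → ℕ → Set
Edges k m = Vector (Fin k × Fin k) m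

incidence : Edges k m → Fin k → Vector ℤ m
incidence es l e = δ (proj₁ (es e)) l - δ (proj₂ (es e)) l

-- The last column starts as all ones; general weights w record how many original vertices each
-- contracted vertex stands for.
weightedIncidence : Edges k m → Vector ℤ k → Fin k → Vector ℤ (suc m)
weightedIncidence es w l = append (incidence es l) (w l)

Respects : Edges k m → (Fin k → Bool) → Fin m → Set
Respects es x e = x (proj₁ (es e)) ≡ x (proj₂ (es e))

-- Connectedness and acyclicity of F in terms of 2-colourings of the vertices, which unlike walks
-- and cycles pass to contractions by plain composition.
Connecting : Edges k m → Subset m → Set
Connecting {k} es F = ∀ (x : Fin k → Bool) → (∀ e → e ∈ F → Respects es x e) → ∀ u v → x u ≡ x v

-- Every edge of F is a bridge: the colouring x is a cut that e alone, among the edges of F,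
-- crosses.
Independent : Edges k m → Subset m → Set
Independent {k} es F = ∀ e → e ∈ F →
  ∃[ x ] (x (proj₁ (es e)) ≢ x (proj₂ (es e)) × (∀ f → f ∈ F → f ≢ e → Respects es x f))

contractEdges : ∀ {i j : Fin (suc k)} → i ≢ j → Edges (suc k) m → Edges k m
contractEdges i≢j es e = contract i≢j (proj₁ (es e)) , contract i≢j (proj₂ (es e))

module _ (es : Edges (suc k) (suc m)) (i≢j : proj₁ (es zero) ≢ proj₂ (es zero)) (F : Subset m) where

  private
    i = proj₁ (es zero)
    j = proj₂ (es zero)

  connecting-contract : Connecting es (inside ∷ F) → Connecting (contractEdges i≢j (tail es)) F
  connecting-contract conn y y-resp u v = begin
    y u                             ≡⟨ cong y (contract-punchIn i≢j u) ⟨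
    y (contract i≢j (punchIn i u))  ≡⟨ conn (y ∘ contract i≢j) resp (punchIn i u) (punchIn i v) ⟩
    y (contract i≢j (punchIn i v))  ≡⟨ cong y (contract-punchIn i≢j v) ⟩
    y v                             ∎
    where
    open ≡-Reasoning
    resp : ∀ e → e ∈ inside ∷ F → Respects es (y ∘ contract i≢j) e
    resp zero    _           = cong y (contract-identifies i≢j)
    resp (suc e) (there e∈F) = y-resp e e∈F

  independent-contract : Independent es (inside ∷ F) → Independent (contractEdges i≢j (tail es)) F
  independent-contract ind e e∈F with ind (suc e) (there e∈F)
  ... | x , x-sep , x-resp = x ∘ punchIn i
      , (λ eq → x-sep (trans (sym (descend _)) (trans eq (descend _))))
      , (λ f f∈F f≢e → trans (descend _) (trans (x-resp (suc f) (there f∈F) λ { refl → f≢e refl }) (sym (descend _))))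
    where
    -- The cut for `suc e` is not crossed by the edge `zero`, so it descends to the contraction.
    descend = punchIn-contract i≢j x (x-resp zero here λ ())

  -- The effect of the row operation on the last column: the weight of i moves to j, so the total is
  -- unchanged.
  contractWeight : Vector ℤ (suc k) → Vector ℤ k
  contractWeight w l = w (punchIn i l) + δ j (punchIn i l) * w i

  sum-contractWeight : ∀ w → sum (contractWeight w) ≡ sum w
  sum-contractWeight w = begin
    sum (contractWeight w)                                          ≡⟨ ∑-distrib-+ (w ∘ punchIn i) _ ⟩
    sum (w ∘ punchIn i) + sum (λ l → δ j (punchIn i l) * w i)       ≡⟨ cong (λ z → sum (w ∘ punchIn i) + z) (*-distribʳ-sum (w i) (δ j ∘ punchIn i)) ⟨
    sum (w ∘ punchIn i) + sum (δ j ∘ punchIn i) * w i               ≡⟨ cong (λ z → sum (w ∘ punchIn i) + z * w i) sum-δ′ ⟩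
    sum (w ∘ punchIn i) + 1ℤ * w i                                  ≡⟨ lemma (sum (w ∘ punchIn i)) (w i) ⟩
    w i + sum (w ∘ punchIn i)                                       ≡⟨ sum-remove {i = i} w ⟨
    sum w                                                           ∎
    where
    open ≡-Reasoning
    lemma : ∀ p q → p + 1ℤ * q ≡ q + p
    lemma = solve-∀
    sum-δ′ : sum (δ j ∘ punchIn i) ≡ 1ℤ
    sum-δ′ = begin
      sum (δ j ∘ punchIn i)         ≡⟨ ℤ.+-identityˡ _ ⟨
      0ℤ + sum (δ j ∘ punchIn i)    ≡⟨ cong (_+ sum (δ j ∘ punchIn i)) (δ-≢ (i≢j ∘ sym)) ⟨
      δ j i + sum (δ j ∘ punchIn i) ≡⟨ sum-remove {i = i} (δ j) ⟨
      sum (δ j)                     ≡⟨ sum-δ j ⟩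
      1ℤ                            ∎

  -- Adding row i to row j clears the first column except for the entry 1 in row i;
  -- the remaining rows form the weighted incidence matrix of the contracted graph.
  wedge-contract : ∀ w → ∃[ s ] (s * s ≡ 1ℤ ×
    wedge (weightedIncidence es w) ((inside ∷ F) ∷ʳ inside) ≡
    s * wedge (weightedIncidence (contractEdges i≢j (tail es)) (contractWeight w)) (F ∷ʳ inside))
  wedge-contract w with wedge-moveToFront (weightedIncidence es w) i
  ... | s , s²≡1 , eq = s , s²≡1 , trans (eq (inside ∷ F′)) (cong (s *_) (begin
    (R i ∧ wedge (R ∘ punchIn i)) (inside ∷ F′)
      ≡⟨ ∧-wedge-shear (R i) (δ j ∘ punchIn i) (R ∘ punchIn i) (inside ∷ F′) ⟨
    head (R i) * wedge R′ (outside ∷ F′) - (tail (R i) ∧ (wedge R′ ∘ (inside ∷_))) F′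
      ≡⟨ cong₂ (λ p q → p * wedge R′ (outside ∷ F′) - q) (cong₂ _-_ (δ-≡ i) (δ-≢ (i≢j ∘ sym)))
           (∧-zeroʳ (tail (R i)) _ (wedge-zeroColumn R′ R′₀≡0) F′) ⟩
    1ℤ * wedge R′ (outside ∷ F′) - 0ℤ
      ≡⟨ lemma _ ⟩
    wedge R′ (outside ∷ F′)
      ≡⟨ wedge-outside R′ F′ ⟩
    wedge (tail ∘ R′) F′
      ≡⟨ wedge-cong tail-R′ F′ ⟩
    wedge (weightedIncidence (contractEdges i≢j (tail es)) (contractWeight w)) F′ ∎))
    where
    open ≡-Reasoning
    F′ = F ∷ʳ inside
    R = weightedIncidence es w
    R′ = λ l e → R (punchIn i l) e + δ j (punchIn i l) * R i e
    lemma : ∀ p → 1ℤ * p - 0ℤ ≡ p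
    lemma = solve-∀
    lemma₀ : ∀ p → 0ℤ - p + p * (1ℤ - 0ℤ) ≡ 0ℤ
    lemma₀ = solve-∀
    R′₀≡0 : ∀ l → head (R′ l) ≡ 0ℤ
    R′₀≡0 l rewrite δ-≢ (punchInᵢ≢i i l ∘ sym) | δ-≡ i | δ-≢ (i≢j ∘ sym) = lemma₀ (δ j (punchIn i l))
    lemma₁ : ∀ p q r p′ q′ → p - q + r * (p′ - q′) ≡ (p + r * p′) - (q + r * q′)
    lemma₁ = solve-∀
    tail-R′ : ∀ l → tail (R′ l) ≗ weightedIncidence (contractEdges i≢j (tail es)) (contractWeight w) l
    tail-R′ l = append-combination (incidence (tail es) (punchIn i l)) (incidence (tail es) i) _
      (w (punchIn i l)) (w i) (δ j (punchIn i l))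
      (λ e → let a , b = es (suc e) in trans
        (lemma₁ (δ a (punchIn i l)) (δ b (punchIn i l)) (δ j (punchIn i l)) (δ a i) (δ b i))
        (sym (cong₂ _-_ (δ-contract i≢j a l) (δ-contract i≢j b l))))
      refl

-- Induction over the edges: one outside F is deleted, one inside F is contracted, which changes the
-- minor by a sign at most and preserves the total weight. Once no edge is left, connectedness
-- leaves at most one vertex, and the minor is its weight.
minor² : ∀ (es : Edges k m) F (w : Vector ℤ k) → Connecting es F → Independent es F →
         let M = wedge (weightedIncidence es w) (F ∷ʳ inside) in M * M ≡ sum w * sum w
-- Without vertices both sides are 0: the minor is the coefficient of `vacuum` at a nonempty set.
minor² {k = zero}        es [] w conn ind = refl
minor² {k = suc zero}    es [] w conn ind = cong (λ z → z * z) (lemma (w zero))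
  where
  lemma : ∀ p → p * 1ℤ - 0ℤ ≡ p + 0ℤ
  lemma = solve-∀
minor² {k = suc (suc k)} es [] w conn ind = contradiction (conn isZero (λ ()) zero (suc zero)) λ ()
  where
  isZero : Fin (suc (suc k)) → Bool
  isZero zero    = true
  isZero (suc _) = false
minor² es (outside ∷ F) w conn ind = trans
  (cong (λ z → z * z) (wedge-outside (weightedIncidence es w) (F ∷ʳ inside)))
  (minor² (tail es) F w
    (λ x x-resp → conn x λ { (suc e) (there e∈F) → x-resp e e∈F })
    (λ e e∈F → let x , x-sep , x-resp = ind (suc e) (there e∈F) in
      x , x-sep , λ f f∈F f≢e → x-resp (suc f) (there f∈F) λ { refl → f≢e refl }))
minor² {k = zero} es (inside ∷ F) w conn ind = contradiction (proj₁ (es zero)) λ ()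
minor² {k = suc k} es (inside ∷ F) w conn ind = begin
  M * M             ≡⟨ cong (λ z → z * z) eq ⟩
  (s * M′) * (s * M′) ≡⟨ lemma s M′ ⟩
  (s * s) * (M′ * M′) ≡⟨ cong₂ _*_ s²≡1 (minor² es′ F w′ (connecting-contract es i≢j F conn) (independent-contract es i≢j F ind)) ⟩
  1ℤ * (sum w′ * sum w′) ≡⟨ ℤ.*-identityˡ _ ⟩
  sum w′ * sum w′   ≡⟨ cong (λ z → z * z) (sum-contractWeight es i≢j F w) ⟩
  sum w * sum w     ∎
  where
  open ≡-Reasoning
  -- No colouring separates the ends of a loop.
  i≢j : proj₁ (es zero) ≢ proj₂ (es zero)
  i≢j i≡j with x , x-sep , _ ← ind zero here = x-sep (cong x i≡j)
  es′ = contractEdges i≢j (tail es)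
  w′ = contractWeight es i≢j F w
  M = wedge (weightedIncidence es w) ((inside ∷ F) ∷ʳ inside)
  M′ = wedge (weightedIncidence es′ w′) (F ∷ʳ inside)
  s = proj₁ (wedge-contract es i≢j F w)
  s²≡1 = proj₁ (proj₂ (wedge-contract es i≢j F w))
  eq = proj₂ (proj₂ (wedge-contract es i≢j F w))
  lemma : ∀ s p → (s * p) * (s * p) ≡ (s * s) * (p * p)
  lemma = solve-∀

-- Walks, paths and spanning trees

lookup-injective : ∀ {A : Set} {xs : List A} → Unique xs → ∀ i j → lookup xs i ≡ lookup xs j → i ≡ j
lookup-injective (_    AllPairs.∷ _) zero    zero    _  = refl
lookup-injective (x∉xs AllPairs.∷ _) zero    (suc j) eq = contradiction eq (All.lookup x∉xs (∈-lookup j))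
lookup-injective (x∉xs AllPairs.∷ _) (suc i) zero    eq = contradiction (sym eq) (All.lookup x∉xs (∈-lookup i))
lookup-injective (_    AllPairs.∷ u) (suc i) (suc j) eq = cong suc (lookup-injective u i j eq)

-- The list holds all vertices after the first, the last one included, to match the vertex lists in
-- `IsCycle`.
data Walk {A : Set} (R : Rel A 0ℓ) : A → List A → A → Set where
  []  : ∀ {u} → Walk R u []ˡ u
  _∷_ : ∀ {u v w vs} → R u v → Walk R v vs w → Walk R u (v ∷ˡ vs) w

module _ {A : Set} {R : Rel A 0ℓ} where

  path-suffix : ∀ {u v w vs} → Walk R v vs w → Unique (v ∷ˡ vs) → u ∈ˡ v ∷ˡ vs →
                ∃[ us ] (Walk R u us w × Unique (u ∷ˡ us))
  path-suffix p       u!                  (Any.here refl) = _ , p , u!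
  path-suffix (_ ∷ p) (_ AllPairs.∷ u!)   (Any.there u∈)  = path-suffix p u! u∈

  walk⇒linked : ∀ {S : Rel A 0ℓ} → R ⇒ S → ∀ {u v w vs} → Walk R u vs v → S v w →
                Linked S (u ∷ˡ vs ∷ʳˡ w)
  walk⇒linked R⇒S []      s = s Linked.∷ Linked.[-]
  walk⇒linked R⇒S (r ∷ p) s = R⇒S r Linked.∷ walk⇒linked R⇒S p s

-- Loop erasure: if u already lies on the path built from the remaining steps, the part of that path
-- before u is cut off; otherwise u is prepended.
star⇒path : ∀ {R : Rel (Fin n) 0ℓ} {u v} → Star R u v → ∃[ vs ] (Walk R u vs v × Unique (u ∷ˡ vs))
star⇒path ε = []ˡ , [] , All.[] AllPairs.∷ AllPairs.[]
star⇒path {u = u} (r ◅ rs) with star⇒path rs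
... | vs , p , u! with DecMembership._∈?_ _≟_ u (_ ∷ˡ vs)
...   | yes u∈ = path-suffix p u! u∈
...   | no  u∉ = _ , r ∷ p , ¬Any⇒All¬ _ u∉ AllPairs.∷ u!

module _ (G : SimpleGraph n) where
  open SimpleGraph G

  edges-unique : Unique (edges G)
  edges-unique = filter⁺ (isEdge? G) (cartesianProduct⁺ (allFin⁺ n) (allFin⁺ n))

  edges-valid : ∀ {i j} → (i , j) ∈ˡ edges G → i Fin.< j × i ~ j
  edges-valid = All.lookup (all-filter (isEdge? G) (cartesianProduct (allFin n) (allFin n)))

  lookup-edges-< : ∀ e {i j} → lookup (edges G) e ≡ (i , j) → i Fin.< j
  lookup-edges-< e eq = proj₁ (edges-valid (subst (_∈ˡ edges G) eq (∈-lookup e)))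

  module _ (F : Subset (length (edges G))) where

    private
      H = spanningSubgraph G F
      es = lookup (edges G)

    connected⇒connecting : Connected H → Connecting es F
    connected⇒connecting conn x x-resp u v = walk (conn u v)
      where
      walk : ∀ {u v} → Star (SimpleGraph._~_ H) u v → x u ≡ x v
      walk ε = refl
      walk ((e , e∈F , inj₁ eq) ◅ p) = trans
        (trans (cong (x ∘ proj₁) (sym eq)) (trans (x-resp e e∈F) (cong (x ∘ proj₂) eq))) (walk p)
      walk ((e , e∈F , inj₂ eq) ◅ p) = trans
        (trans (cong (x ∘ proj₂) (sym eq)) (trans (sym (x-resp e e∈F)) (cong (x ∘ proj₁) eq))) (walk p)

    -- Vertices are coloured by whether they can be reached from one end of e through the other
    -- edges of F. Such an edge never leaves its colour class, and e does, since otherwise a path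
    -- around e would close up to a cycle.
    acyclic⇒independent : Acyclic H → Independent es F
    acyclic⇒independent acyclic e e∈F = x , x-sep , x-resp
      where
      i = proj₁ (es e)
      j = proj₂ (es e)

      _≈_ : Rel (Fin n) 0ℓ
      u ≈ v = ∃[ f ] (f ≢ e × f ∈ F × (es f ≡ (u , v) ⊎ es f ≡ (v , u)))

      _≈?_ : Decidable _≈_
      u ≈? v = any? λ f → ¬? (f ≟ e) ×-dec f ∈? F ×-dec (es f ≟² (u , v) ⊎-dec es f ≟² (v , u))
        where _≟²_ = ≡-dec _≟_ _≟_

      no-bypass : ∀ {u v} → es e ≡ (u , v) → ¬ Star _≈_ u v
      no-bypass {u} e≡ p with star⇒path p
      -- A bypass of length 0 would make e a loop, and one of length 1 a second listing of the edge
      -- e; a longer one has the two further vertices that a cycle requires.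
      ... | _ , [] , _ = <-irrefl refl (lookup-edges-< e e≡)
      ... | _ , ((f , f≢e , _ , inj₁ f≡) ∷ []) , _ = f≢e (lookup-injective edges-unique f e (trans f≡ (sym e≡)))
      ... | _ , ((f , _ , _ , inj₂ f≡) ∷ []) , _ = <-asym (lookup-edges-< e e≡) (lookup-edges-< f f≡)
      ... | vs , q@(_ ∷ (_ ∷ _)) , u! = acyclic
        (u , vs , walk⇒linked (λ (f , _ , rest) → f , rest) q (e , e∈F , inj₂ e≡) , u! , s≤s (s≤s z≤n))

      x : Fin n → Bool
      x v = does (star? _≈?_ i v)

      x-sep : x i ≢ x j
      x-sep eq with trans (sym (dec-true (star? _≈?_ i i) ε)) (trans eq (dec-false (star? _≈?_ i j) (no-bypass refl)))
      ... | ()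

      x-resp : ∀ f → f ∈ F → f ≢ e → Respects es x f
      x-resp f f∈F f≢e = does-⇔
        (mk⇔ (_◅◅ ((f , f≢e , f∈F , inj₁ refl) ◅ ε)) (_◅◅ ((f , f≢e , f∈F , inj₂ refl) ◅ ε)))
        (star? _≈?_ i _) (star? _≈?_ i _)

-- Norms of the rows

∣append∣² : ∀ (v : Vector ℤ m) s → ∣ append v s ∣² ≡ ∣ v ∣² + s * s
∣append∣² {zero}  v s = ℤ.+-comm (s * s) 0ℤ
∣append∣² {suc m} v s = trans (cong (λ z → head v * head v + z) (∣append∣² (tail v) s))
                              (sym (ℤ.+-assoc (head v * head v) ∣ tail v ∣² (s * s)))

Incident : Fin n → Fin n × Fin n → Set
Incident l (a , b) = a ≡ l ⊎ b ≡ l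

incident? : ∀ (l : Fin n) → Unary.Decidable (Incident l)
incident? l (a , b) = a ≟ l ⊎-dec b ≟ l

-- An edge at l has entry 1 or -1 there, with square 1. A loop at l would have entry 0 and yet be
-- counted, hence the assumption on es.
∣incidence∣² : ∀ (es : List (Fin n × Fin n)) → All (λ (a , b) → a ≢ b) es → ∀ l →
               ∣ incidence (lookup es) l ∣² ≡ + length (filter (incident? l) es)
∣incidence∣² []ˡ All.[] l = refl
∣incidence∣² ((a , b) ∷ˡ es) (a≢b All.∷ es-proper) l with a ≟ l | b ≟ l
... | yes refl | yes refl = contradiction refl a≢b
... | yes _    | no  _    = cong (λ z → 1ℤ + z) (∣incidence∣² es es-proper l)
... | no  _    | yes _    = cong (λ z → 1ℤ + z) (∣incidence∣² es es-proper l)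
... | no  _    | no  _    = trans (ℤ.+-identityˡ _) (∣incidence∣² es es-proper l)

module _ (G : SimpleGraph n) (l : Fin n) where
  open SimpleGraph G

  private
    L = filter (incident? l) (edges G)

    Joins : Fin n × Fin n → Fin n → Set
    Joins (a , b) v = (a ≡ l × b ≡ v) ⊎ (b ≡ l × a ≡ v)

    L-edge : ∀ p → lookup L p ∈ˡ edges G × Incident l (lookup L p)
    L-edge p = ∈-filter⁻ (incident? l) {xs = edges G} (∈-lookup p)

    neighbour : ∀ p → ∃[ v ] (v ∈ˡ filter (l ~?_) (allFin n) × Joins (lookup L p) v)
    neighbour p with lookup L p | L-edge p
    ... | a , b | e∈ , inj₁ refl = b , ∈-filter⁺ (l ~?_) (∈-allFin b) (proj₂ (edges-valid G e∈)) , inj₁ (refl , refl)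
    ... | a , b | e∈ , inj₂ refl = a , ∈-filter⁺ (l ~?_) (∈-allFin a) (~-sym (proj₂ (edges-valid G e∈))) , inj₂ (refl , refl)

    joins-injective : ∀ {e f v} → e ∈ˡ edges G → f ∈ˡ edges G → Joins e v → Joins f v → e ≡ f
    joins-injective _  _  (inj₁ (refl , refl)) (inj₁ (refl , refl)) = refl
    -- In the mixed cases both (l , v) and (v , l) would be listed, although listed pairs increase.
    joins-injective e∈ f∈ (inj₁ (refl , refl)) (inj₂ (refl , refl)) =
      contradiction (proj₁ (edges-valid G f∈)) (<-asym (proj₁ (edges-valid G e∈)))
    joins-injective e∈ f∈ (inj₂ (refl , refl)) (inj₁ (refl , refl)) =
      contradiction (proj₁ (edges-valid G f∈)) (<-asym (proj₁ (edges-valid G e∈)))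
    joins-injective _  _  (inj₂ (refl , refl)) (inj₂ (refl , refl)) = refl

  -- Each edge at l is sent to the position of its other end among the neighbours of l. This is
  -- injective because every edge is listed only once.
  length-incident≤degree : length L ℕ.≤ degree G l
  length-incident≤degree = injective⇒≤ {f = λ p → Any.index (proj₁ (proj₂ (neighbour p)))} λ {p} {q} eq →
    lookup-injective (filter⁺ (incident? l) (edges-unique G)) p q
      (joins-injective (proj₁ (L-edge p)) (proj₁ (L-edge q)) (proj₂ (proj₂ (neighbour p)))
        (subst (Joins (lookup L q)) (sym (index-injective (setoid (Fin n)) _ _ eq)) (proj₂ (proj₂ (neighbour q)))))

  ∣row∣²≤ : ∣ weightedIncidence (lookup (edges G)) (λ _ → 1ℤ) l ∣² ℤ.≤ + suc (degree G l)
  ∣row∣²≤ = begin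
    ∣ append (incidence (lookup (edges G)) l) 1ℤ ∣² ≡⟨ ∣append∣² (incidence (lookup (edges G)) l) 1ℤ ⟩
    ∣ incidence (lookup (edges G)) l ∣² + 1ℤ        ≡⟨ cong (_+ 1ℤ) (∣incidence∣² (edges G) proper l) ⟩
    + length L + 1ℤ                                 ≡⟨ ℤ.+-comm (+ length L) 1ℤ ⟩
    + suc (length L)                                ≤⟨ ℤ.+≤+ (s≤s length-incident≤degree) ⟩
    + suc (degree G l)                              ∎
    where
    open ℤ.≤-Reasoning
    proper : All (λ (a , b) → a ≢ b) (edges G)
    proper = All.tabulate λ e∈ → λ { refl → <-irrefl refl (proj₁ (edges-valid G e∈)) }

-- Bounding the number of spanning trees, over ℤ and then over ℚ

sum-1 : ∀ k → sum {k} (λ _ → 1ℤ) ≡ + k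
sum-1 zero    = refl
sum-1 (suc k) = cong (λ z → 1ℤ + z) (sum-1 k)

-- Only coefficients at sets containing the column of ones are kept. Among these each spanning tree
-- accounts for n * n, and the remaining squares are nonnegative.
n²τ≤∏ : ∀ (G : SimpleGraph n) → + τ G * (+ n * + n) ℤ.≤ + product (tabulate (suc ∘ degree G))
n²τ≤∏ {n} G = begin
  + τ G * (+ n * + n)                          ≤⟨ length-filter-subsets-≤ (isTree? ∘ spanningSubgraph G) (sq ∘ (_∷ʳ inside)) _
                                                    (λ F → sq-nonneg (F ∷ʳ inside)) tree≤ ⟩
  ∑ (sq ∘ (_∷ʳ inside))                        ≤⟨ ℤ.i≤j+i _ _ {{ℤ.nonNegative (∥∥²-nonneg (ω ∘ (_∷ʳ outside)))}} ⟩
  ∑ (sq ∘ (_∷ʳ outside)) + ∑ (sq ∘ (_∷ʳ inside)) ≡⟨ ∑-∷ʳ sq ⟨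
  ∥ ω ∥²                                       ≤⟨ hadamard R (suc ∘ degree G) (∣row∣²≤ G) ⟩
  + product (tabulate (suc ∘ degree G))        ∎
  where
  open ℤ.≤-Reasoning
  R = weightedIncidence (lookup (edges G)) (λ _ → 1ℤ)
  ω = wedge R
  sq : Subset (suc (length (edges G))) → ℤ
  sq F = ω F * ω F
  sq-nonneg : ∀ F → 0ℤ ℤ.≤ sq F
  -- A single square is the norm of a form on ℤ⁰, which has one coefficient.
  sq-nonneg F = ∥∥²-nonneg {zero} (λ _ → ω F)
  tree≤ : ∀ F → IsTree (spanningSubgraph G F) → + n * + n ℤ.≤ sq (F ∷ʳ inside)
  tree≤ F (conn , acyclic) = ℤ.≤-reflexive (sym (trans
    (minor² (lookup (edges G)) F (λ _ → 1ℤ) (connected⇒connecting G F conn) (acyclic⇒independent G F acyclic))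
    (cong (λ z → z * z) (sum-1 n))))

-- `_/_` reduces to lowest terms, so the comparison is made between unnormalised fractions, by
-- cross-multiplication.
/-mono : ∀ t d p .{{_ : NonZero d}} → t ℕ.* d ℕ.≤ p → (+ t) / 1 ≤ (+ p) / d
/-mono t (suc d) p td≤p = toℚᵘ-cancel-≤ (begin
  -- `mkℚᵘ` stores the denominator minus one: 0 stands for 1, and d for suc d.
  _               ≃⟨ toℚᵘ-fromℚᵘ (mkℚᵘ (+ t) 0) ⟩
  mkℚᵘ (+ t) 0    ≤⟨ *≤* (ℤ.≤-trans (ℤ.≤-reflexive (sym (ℤ.pos-* t (suc d))))
                       (ℤ.≤-trans (ℤ.+≤+ td≤p) (ℤ.≤-reflexive (sym (ℤ.*-identityʳ (+ p)))))) ⟩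
  mkℚᵘ (+ p) d    ≃⟨ toℚᵘ-fromℚᵘ (mkℚᵘ (+ p) d) ⟨
  _               ∎)
  where open ℚᵘ.≤-Reasoning

theorem1p1 : ∀ (n : ℕ) .{{_ : NonZero n}} (G : SimpleGraph n)
    (ds : List ℕ) → Sorted ≤-totalOrder ds → ds ↭ degrees G →
    (+ τ G) / 1 ≤ _/_ (+ product (map suc ds)) (n ^ 2) {{m^n≢0 n 2}}
theorem1p1 n G ds _ ds↭ = /-mono (τ G) (n ^ 2) (product (map suc ds)) {{m^n≢0 n 2}} (ℤ.drop‿+≤+ (begin
  + (τ G ℕ.* n ^ 2)                     ≡⟨ ℤ.pos-* (τ G) (n ^ 2) ⟩
  + τ G * + (n ^ 2)                     ≡⟨ cong (λ z → + τ G * + (n ℕ.* z)) (ℕ.*-identityʳ n) ⟩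
  + τ G * + (n ℕ.* n)                   ≡⟨ cong (λ z → + τ G * z) (ℤ.pos-* n n) ⟩
  + τ G * (+ n * + n)                   ≤⟨ n²τ≤∏ G ⟩
  + product (tabulate (suc ∘ degree G)) ≡⟨ cong (+_ ∘ product) (trans (cong (map suc) (List.map-tabulate (λ i → i) (degree G))) (List.map-tabulate (degree G) suc)) ⟨
  + product (map suc (degrees G))       ≡⟨ cong +_ (product-↭ (map⁺ suc ds↭)) ⟨
  + product (map suc ds)                ∎))
  where open ℤ.≤-Reasoning
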